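{- $\lambda(ABCA.ACBA.ABCBA)=4$.
   Context: A formula is a finite set of non-empty words over variables (fragments), written separated by dots. An occurrence of a formula $f$ in a word $w$ over an alphabet $\Sigma$ is a non-erasing morphism $h$ from variables to non-empty words over $\Sigma$ such that $h(\phi)$ is a factor of $w$ for every fragment $\phi$; $\lambda(f)$ is the smallest size of an alphabet over which there exists an infinite word containing no occurrence of $f$. -}

module Defs where

open import Data.Nat using (ℕ; _+_; _<_)
open import Data.Fin using (Fin; zero; suc)
open import Data.List using (List; []; _∷_; length; map; upTo; concatMap)
open import Data.List.Relation.Unary.All using (All)
open import Data.Product using (Σ; _×_; ∃)
open import Relation.Binary.PropositionalEquality using (_≡_; _≢_)
open import Relation.Nullary using (¬_)

Word : ℕ → Set
Word k = List (Fin k)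

InfWord : ℕ → Set
InfWord k = ℕ → Fin k

record Formula (v : ℕ) : Set where
  field
    fragments   : List (List (Fin v))
    nonEmptyFr  : All (λ φ → φ ≢ []) fragments
open Formula public

IsFactor : ∀ {k} → Word k → InfWord k → Set
IsFactor u w = ∃ λ i → u ≡ map (λ j → w (i + j)) (upTo (length u))

apply : ∀ {v k} → (Fin v → Word k) → List (Fin v) → Word k
apply h φ = concatMap h φ

Occurrence : ∀ {v k} → Formula v → InfWord k → Set
Occurrence {v} {k} f w =
  Σ (Fin v → Word k) λ h →
    ((x : Fin v) → h x ≢ []) × All (λ φ → IsFactor (apply h φ) w) (fragments f)

AvoidableOver : ∀ {v} → Formula v → ℕ → Set
AvoidableOver f k = Σ (InfWord k) λ w → ¬ Occurrence f w

AvoidabilityIndex : ∀ {v} → Formula v → ℕ → Set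
AvoidabilityIndex f n = AvoidableOver f n × (∀ k → k < n → ¬ AvoidableOver f k)

A B C : Fin 3
A = zero
B = suc zero
C = suc (suc zero)

f17 : Formula 3
f17 = record
  { fragments  = (A ∷ B ∷ C ∷ A ∷ []) ∷ (A ∷ C ∷ B ∷ A ∷ []) ∷ (A ∷ B ∷ C ∷ B ∷ A ∷ []) ∷ []
  ; nonEmptyFr = (λ ()) All.∷ (λ ()) All.∷ (λ ()) All.∷ All.[]
  }

{-# OPTIONS --safe #-}

-- Four letters suffice: the word whose n-th letter records the parity of n
-- together with the n-th bit of the paperfolding sequence avoids even
-- ABCA.ACBA. Equal factors of this word start at positions of equal parity,
-- which forces the images of A, B and C to have even length; reading only the
-- odd positions of the word gives the word back, so an occurrence can be halved
-- forever.
--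
-- Three letters do not suffice: taking A = B shows that a square xx cannot occur
-- again after a gap, so a word avoiding the formula has a suffix free of short
-- squares. Exhaustive search shows that such a suffix contains an occurrence
-- whose images of A, B and C have lengths 1, 1, 1 or 1, 2, 3.

module Submission where

open import Defs
open import Data.Bool using (Bool; true; false; _∧_; _∨_; not; T)
open import Data.Bool.ListAction using (all; any)
open import Data.Bool.Properties using (T-∧; T-∨; T-≡)
open import Data.Empty using (⊥; ⊥-elim)
open import Data.Fin using (Fin; zero; suc; toℕ; fromℕ<)
open import Data.Fin.Properties using (toℕ-fromℕ<)
open import Data.List using (List; []; _∷_; _++_; length; applyUpTo; take; drop; reverse; null; allFin)
open import Data.List.Properties using (∷-injective; map-upTo; ++-identityʳ; length-take; take++drop≡id; unfold-reverse; length-reverse; reverse-involutive; length-++; reverse-++; concatMap-++)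
open import Data.List.Membership.Propositional using (find)
open import Data.List.Membership.Propositional.Properties using (∈-allFin)
open import Data.List.Relation.Unary.All as All using (All; []; _∷_)
open import Data.List.Relation.Unary.All.Properties using (all⁺)
open import Data.List.Relation.Unary.Any.Properties using (any⁻)
open import Data.List.Relation.Unary.Any using (satisfied)
open import Data.Nat using (ℕ; zero; suc; _+_; _≤_; _<_; z≤n; s≤s; _⊔_; parity; _≤?_)
open import Data.Nat.Binary using (ℕᵇ; 2[1+_]; 1+[2_]; fromℕ') renaming (zero to 0ᵇ; suc to sucᵇ)
open import Data.Nat.Induction using (<-wellFounded)
open import Data.Nat.Properties using (+-assoc; +-comm; +-suc; +-identityʳ; ≤-reflexive; ≤-trans; m≤m+n; m≤m⊔n; m≤n⊔m; m⊓n≤m; m<m+n; +-mono-<; +-mono-≤; m<1+n⇒m<n∨m≡n; m≤n⇒∃[o]m+o≡n)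
open import Data.Nat.Tactic.RingSolver using (solve-∀)
open import Data.Parity using (Parity; 0ℙ; 1ℙ; _⁻¹) renaming (_+_ to _+ᵖ_)
open import Data.Parity.Properties using (suc-homo-⁻¹; +-homo-+; ⁻¹-involutive; ⁻¹-injective; +-cancelˡ-≡) renaming (+-identityʳ to +ᵖ-identityʳ)
open import Data.Product using (∃; _×_; _,_; proj₁; proj₂)
open import Data.Sum using (inj₁; inj₂; [_,_]′)
open import Data.Unit using (⊤; tt)
open import Function using (_∘_; Equivalence)
open import Induction.WellFounded using (Acc; acc)
open import Relation.Binary.PropositionalEquality using (_≡_; _≢_; refl; sym; trans; cong; cong₂; subst; subst₂; module ≡-Reasoning)
open import Relation.Nullary using (¬_; contradiction)
open import Relation.Nullary.Decidable using (toWitness)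

private
  variable
    k : ℕ

-- Factors by position

At : InfWord k → ℕ → Word k → Set
At w p []      = ⊤
At w p (x ∷ u) = x ≡ w p × At w (suc p) u

-- Equality of two factors in terms of positions and length alone, the form in which factors can be
-- halved.
record Agree (w : InfWord k) (l p q : ℕ) : Set where
  constructor agreeing
  field letters : ∀ i → i < l → w (p + i) ≡ w (q + i)
open Agree

module _ {k : ℕ} (w : InfWord k) where

  private
    next : ∀ {g : ℕ → Fin k} {p} → (∀ j → g j ≡ w (p + j)) → ∀ j → g (suc j) ≡ w (suc p + j)
    next {p = p} g≗ j = trans (g≗ (suc j)) (cong w (+-suc p j))

  -- `g` is arbitrary because `applyUpTo` passes to `g ∘ suc` at each letter, while `p` advances by
  -- one.
  applyUpTo⇒At : ∀ {g : ℕ → Fin k} {p} u → (∀ j → g j ≡ w (p + j)) → u ≡ applyUpTo g (length u) → At w p u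
  applyUpTo⇒At         []      g≗ eq = tt
  applyUpTo⇒At {p = p} (x ∷ u) g≗ eq with ∷-injective eq
  ... | x≡ , u≡ = trans x≡ (trans (g≗ 0) (cong w (+-identityʳ p))) , applyUpTo⇒At u (next g≗) u≡

  At⇒applyUpTo : ∀ {g : ℕ → Fin k} {p} u → (∀ j → g j ≡ w (p + j)) → At w p u → u ≡ applyUpTo g (length u)
  At⇒applyUpTo         []      g≗ _ = refl
  At⇒applyUpTo {p = p} (x ∷ u) g≗ (x≡ , at) =
    cong₂ _∷_ (trans x≡ (sym (trans (g≗ 0) (cong w (+-identityʳ p))))) (At⇒applyUpTo u (next g≗) at)

  IsFactor⇒At : ∀ {u} → IsFactor u w → ∃ λ p → At w p u
  IsFactor⇒At {u} (p , eq) = p , applyUpTo⇒At u (λ _ → refl) (trans eq (map-upTo _ (length u)))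

  At⇒IsFactor : ∀ {p u} → At w p u → IsFactor u w
  At⇒IsFactor {p} {u} at = p , trans (At⇒applyUpTo u (λ _ → refl) at) (sym (map-upTo _ (length u)))

  At-++⁺ : ∀ {p} u {v} → At w p u → At w (p + length u) v → At w p (u ++ v)
  At-++⁺ {p} []      {v} _ at = subst (λ q → At w q v) (+-identityʳ p) at
  At-++⁺ {p} (x ∷ u) {v} (x≡ , atᵤ) at = x≡ , At-++⁺ u atᵤ (subst (λ q → At w q v) (+-suc p _) at)

  At-++⁻ : ∀ {p} u {v} → At w p (u ++ v) → At w p u × At w (p + length u) v
  At-++⁻ {p} []      {v} at = tt , subst (λ q → At w q v) (sym (+-identityʳ p)) at
  At-++⁻ {p} (x ∷ u) {v} (x≡ , at) with At-++⁻ u at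
  ... | atᵤ , atᵥ = (x≡ , atᵤ) , subst (λ q → At w q v) (sym (+-suc p _)) atᵥ

  At⇒Agree : ∀ {p q} u → At w p u → At w q u → Agree w (length u) p q
  At⇒Agree u at at′ = agreeing (same u at at′)
    where
    same : ∀ {p q} u → At w p u → At w q u → ∀ i → i < length u → w (p + i) ≡ w (q + i)
    same {p} {q} (x ∷ u) (x≡ , _) (x≡′ , _) zero _ =
      trans (cong w (+-identityʳ p)) (trans (sym x≡) (trans x≡′ (cong w (sym (+-identityʳ q)))))
    same {p} {q} (x ∷ u) (_ , at) (_ , at′) (suc i) (s≤s i<) =
      trans (cong w (+-suc p i)) (trans (same u at at′ i i<) (cong w (sym (+-suc q i))))

  Agree⇒At : ∀ {p q} u → Agree w (length u) p q → At w p u → At w q u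
  Agree⇒At []      _ _ = tt
  Agree⇒At {p} {q} (x ∷ u) (agreeing same) (x≡ , at) =
      trans x≡ (trans (cong w (sym (+-identityʳ p))) (trans (same 0 (s≤s z≤n)) (cong w (+-identityʳ q))))
    , Agree⇒At u (agreeing λ i i< →
        trans (cong w (sym (+-suc p i))) (trans (same (suc i) (s≤s i<)) (cong w (+-suc q i)))) at

  window : ℕ → ℕ → Word k
  window p zero    = []
  window p (suc l) = w p ∷ window (suc p) l

  length-window : ∀ p l → length (window p l) ≡ l
  length-window p zero    = refl
  length-window p (suc l) = cong suc (length-window (suc p) l)

  At-window : ∀ p l → At w p (window p l)
  At-window p zero    = tt
  At-window p (suc l) = refl , At-window (suc p) l

-- The paperfolding word

parityᵇ : ℕᵇ → Parity
parityᵇ 0ᵇ       = 0ℙ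
parityᵇ 2[1+ x ] = 0ℙ
parityᵇ 1+[2 x ] = 1ℙ

-- The Toeplitz recursion: even positions carry alternating bits, odd positions carry the sequence
-- again. The half of `2[1+ x ]` is `1 + x`, whose parity is opposite to that of `x`.
foldᵇ : ℕᵇ → Parity
foldᵇ 0ᵇ       = 0ℙ
foldᵇ 2[1+ x ] = parityᵇ x ⁻¹
foldᵇ 1+[2 x ] = foldᵇ x

fold : ℕ → Parity
fold n = foldᵇ (fromℕ' n)

parity-suc : ∀ n → parity (suc n) ≡ parity n ⁻¹
parity-suc n = trans (sym (⁻¹-involutive _)) (cong _⁻¹ (suc-homo-⁻¹ n))

parityᵇ-suc : ∀ x → parityᵇ (sucᵇ x) ≡ parityᵇ x ⁻¹
parityᵇ-suc 0ᵇ       = refl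
parityᵇ-suc 2[1+ x ] = refl
parityᵇ-suc 1+[2 x ] = refl

parityᵇ-fromℕ' : ∀ n → parityᵇ (fromℕ' n) ≡ parity n
parityᵇ-fromℕ' zero    = refl
parityᵇ-fromℕ' (suc n) =
  trans (parityᵇ-suc (fromℕ' n)) (trans (cong _⁻¹ (parityᵇ-fromℕ' n)) (sym (parity-suc n)))

fromℕ'-odd : ∀ n → fromℕ' (suc (n + n)) ≡ 1+[2 fromℕ' n ]
fromℕ'-odd zero    = refl
fromℕ'-odd (suc n) rewrite +-suc n n | fromℕ'-odd n = refl

fold-odd : ∀ n → fold (suc (n + n)) ≡ fold n
fold-odd n = cong foldᵇ (fromℕ'-odd n)

fold-even : ∀ n → fold (n + n) ≡ parity n
fold-even zero    = refl
fold-even (suc n) rewrite +-suc n n | fromℕ'-odd n =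
  trans (cong _⁻¹ (parityᵇ-fromℕ' n)) (sym (parity-suc n))

code : Parity → Parity → Fin 4
code 0ℙ 0ℙ = zero
code 1ℙ 0ℙ = suc zero
code 0ℙ 1ℙ = suc (suc zero)
code 1ℙ 1ℙ = suc (suc (suc zero))

decode : Fin 4 → Parity × Parity
decode zero                   = 0ℙ , 0ℙ
decode (suc zero)             = 1ℙ , 0ℙ
decode (suc (suc zero))       = 0ℙ , 1ℙ
decode (suc (suc (suc zero))) = 1ℙ , 1ℙ

decode-code : ∀ x y → decode (code x y) ≡ (x , y)
decode-code 0ℙ 0ℙ = refl
decode-code 0ℙ 1ℙ = refl
decode-code 1ℙ 0ℙ = refl
decode-code 1ℙ 1ℙ = refl

-- The fixed point of 0 ↦ 01, 1 ↦ 21, 2 ↦ 03, 3 ↦ 23.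
paper : InfWord 4
paper n = code (parity n) (fold n)

paper-injective : ∀ m n → paper m ≡ paper n → parity m ≡ parity n × fold m ≡ fold n
paper-injective m n eq = cong proj₁ pairs , cong proj₂ pairs
  where
  pairs : (parity m , fold m) ≡ (parity n , fold n)
  pairs = trans (sym (decode-code _ _)) (trans (cong decode eq) (decode-code _ _))

-- Parities of positions and lengths

parity-+-congˡ : ∀ m n d → parity m ≡ parity n → parity (m + d) ≡ parity (n + d)
parity-+-congˡ m n d eq = trans (+-homo-+ m d) (trans (cong (_+ᵖ parity d) eq) (sym (+-homo-+ n d)))

parity-shift : ∀ m d → parity m ≡ parity (m + d) → parity d ≡ 0ℙ
parity-shift m d eq =
  sym (+-cancelˡ-≡ (parity m) 0ℙ (parity d) (trans (+ᵖ-identityʳ (parity m)) (trans eq (+-homo-+ m d))))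

parity-double : ∀ n → parity (n + n) ≡ 0ℙ
parity-double zero    = refl
parity-double (suc n) rewrite +-suc n n = parity-double n

parity-+-double : ∀ m n → parity (m + (n + n)) ≡ parity m
parity-+-double m n =
  trans (+-homo-+ m (n + n)) (trans (cong (parity m +ᵖ_) (parity-double n)) (+ᵖ-identityʳ (parity m)))

-- Halving positions and factors

⟦_⟧ : Parity → ℕ
⟦ 0ℙ ⟧ = 0
⟦ 1ℙ ⟧ = 1

halve : ∀ n → ∃ λ m → n ≡ ⟦ parity n ⟧ + (m + m)
halve zero          = 0 , refl
halve (suc zero)    = 0 , refl
halve (suc (suc n)) with halve n
... | m , eq = suc m , trans (cong (2 +_) eq) (shift ⟦ parity n ⟧ m)
  where
  shift : ∀ s m → suc (suc (s + (m + m))) ≡ s + (suc m + suc m)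
  shift = solve-∀

halve-even : ∀ n → parity n ≡ 0ℙ → ∃ λ m → n ≡ m + m
halve-even n even with halve n
... | m , eq rewrite even = m , eq

halve-positive : ∀ {n} → 0 < n + n → 0 < n
halve-positive {suc n} _ = s≤s z≤n

-- The even positions inside the factor fix the parity of the halved
-- starting position, the odd ones carry the halved word.
Agree-halve : ∀ s {l P Q} p q → 0 < l → P ≡ ⟦ s ⟧ + (p + p) → Q ≡ ⟦ s ⟧ + (q + q) →
              Agree paper (l + l) P Q → Agree paper l p q
Agree-halve s {l} p q 0<l refl refl (agreeing same) = agreeing λ i i<l →
  cong₂ code (parity-+-congˡ p q i (parities s same))
             (trans (sym (fold-odd (p + i))) (trans (folds s same i i<l) (fold-odd (q + i))))
  where
  Same : Parity → Set
  Same s = ∀ i → i < l + l → paper (⟦ s ⟧ + (p + p) + i) ≡ paper (⟦ s ⟧ + (q + q) + i)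

  same-fold : ∀ {x y} x′ y′ → x ≡ x′ → y ≡ y′ → paper x ≡ paper y → fold x′ ≡ fold y′
  same-fold x y refl refl eq = proj₂ (paper-injective x y eq)

  parities : ∀ s → Same s → parity p ≡ parity q
  parities 0ℙ same = trans (sym (fold-even p)) (trans
    (same-fold (p + p) (q + q) (+-identityʳ _) (+-identityʳ _) (same 0 (≤-trans 0<l (m≤m+n l l))))
    (fold-even q))
  -- From an odd start the first even position lies one letter further; `0 < l` makes the factor
  -- long enough to reach it.
  parities 1ℙ same = ⁻¹-injective (trans (sym (parity-suc p)) (trans
    (trans (sym (fold-even (suc p))) (trans
      (same-fold (suc p + suc p) (suc q + suc q) (next p) (next q) (same 1 (+-mono-≤ 0<l 0<l)))
      (fold-even (suc q))))
    (parity-suc q)))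
    where
    next : ∀ x → 1 + (x + x) + 1 ≡ suc x + suc x
    next = solve-∀

  folds : ∀ s → Same s → ∀ i → i < l → fold (suc ((p + i) + (p + i))) ≡ fold (suc ((q + i) + (q + i)))
  folds 0ℙ same i i<l = same-fold _ _ (odd p i) (odd q i)
    (same (suc (i + i)) (subst (_≤ l + l) (cong suc (+-suc i i)) (+-mono-≤ i<l i<l)))
    where
    odd : ∀ x i → x + x + suc (i + i) ≡ suc ((x + i) + (x + i))
    odd = solve-∀
  folds 1ℙ same i i<l = same-fold _ _ (odd p i) (odd q i) (same (i + i) (+-mono-< i<l i<l))
    where
    odd : ∀ x i → suc (x + x) + (i + i) ≡ suc ((x + i) + (x + i))
    odd = solve-∀

Agree⇒parity : ∀ {l p q} → 0 < l → Agree paper l p q → parity p ≡ parity q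
Agree⇒parity {l} {p} {q} 0<l agree =
  proj₁ (paper-injective p q
    (subst₂ (λ x y → paper x ≡ paper y) (+-identityʳ p) (+-identityʳ q) (letters agree 0 0<l)))

-- ABCA occurs at p and ACBA at q, with |A| = a, |B| = b, |C| = c.
paper-avoids : ∀ {a} b c p q → Acc _<_ a → 0 < a → 0 < b → 0 < c →
               Agree paper a p q → Agree paper a p (p + a + b + c) →
               Agree paper b (p + a) (q + a + c) → Agree paper c (p + a + b) (q + a) → ⊥
paper-avoids {a} b c p q (acc rec) 0<a 0<b 0<c A₁ A₂ B₁ C₁ = finish
  where
  p≡q : parity p ≡ parity q
  p≡q = Agree⇒parity 0<a A₁
  -- `B` starts at `p + a` and at `q + a + c`, and `p`, `q` have equal parity, so `c` is even.
  -- Comparing the two starts of `C` does the same for `b`.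
  c-even : parity c ≡ 0ℙ
  c-even = parity-shift (q + a) c (trans (sym (parity-+-congˡ p q a p≡q)) (Agree⇒parity 0<b B₁))
  b-even : parity b ≡ 0ℙ
  b-even = parity-shift (p + a) b (trans (parity-+-congˡ p q a p≡q) (sym (Agree⇒parity 0<c C₁)))
  finish : ⊥
  finish with halve-even b b-even | halve-even c c-even
  ... | b′ , refl | c′ , refl
    -- `A` recurs at distance `a + b + c`; with `b` and `c` even, `a` is even too.
    with halve-even a (parity-shift p a (trans (Agree⇒parity 0<a A₂)
           (trans (parity-+-double (p + a + (b′ + b′)) c′) (parity-+-double (p + a) b′))))
  ... | a′ , refl with halve p | halve q
  ... | p′ , p≡ | q′ , q≡ =
    paper-avoids b′ c′ p′ q′ (rec (m<m+n a′ 0<a′)) 0<a′ (halve-positive 0<b) (halve-positive 0<c)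
      (Agree-halve s _ _ 0<a′ p≡ q≡′ A₁)
      (Agree-halve s _ _ 0<a′ p≡
        (trans (cong (λ x → x + (a′ + a′) + (b′ + b′) + (c′ + c′)) p≡) (three ⟦ s ⟧ p′ a′ b′ c′)) A₂)
      (Agree-halve s _ _ (halve-positive 0<b)
        (trans (cong (_+ (a′ + a′)) p≡) (one ⟦ s ⟧ p′ a′))
        (trans (cong (λ x → x + (a′ + a′) + (c′ + c′)) q≡′) (two ⟦ s ⟧ q′ a′ c′)) B₁)
      (Agree-halve s _ _ (halve-positive 0<c)
        (trans (cong (λ x → x + (a′ + a′) + (b′ + b′)) p≡) (two ⟦ s ⟧ p′ a′ b′))
        (trans (cong (_+ (a′ + a′)) q≡′) (one ⟦ s ⟧ q′ a′)) C₁)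
    where
    s : Parity
    s = parity p
    q≡′ : q ≡ ⟦ s ⟧ + (q′ + q′)
    q≡′ = trans q≡ (cong (λ t → ⟦ t ⟧ + (q′ + q′)) (sym p≡q))
    0<a′ : 0 < a′
    0<a′ = halve-positive 0<a
    one : ∀ s x a → s + (x + x) + (a + a) ≡ s + ((x + a) + (x + a))
    one = solve-∀
    two : ∀ s x a b → s + (x + x) + (a + a) + (b + b) ≡ s + ((x + a + b) + (x + a + b))
    two = solve-∀
    three : ∀ s x a b c → s + (x + x) + (a + a) + (b + b) + (c + c) ≡ s + ((x + a + b + c) + (x + a + b + c))
    three = solve-∀

-- The upper bound: four letters

length-positive : {u : Word k} → u ≢ [] → 0 < length u
length-positive {u = []}    u≢[] = ⊥-elim (u≢[] refl)
length-positive {u = _ ∷ _} _    = s≤s z≤n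

four-letters : AvoidableOver f17 4
four-letters = paper , no-occurrence
  where
  no-occurrence : ¬ Occurrence f17 paper
  no-occurrence (h , h≢[] , (F₁ ∷ F₂ ∷ _)) with IsFactor⇒At paper F₁ | IsFactor⇒At paper F₂
  ... | p , at | q , at′
    with At-++⁻ paper (h A) at | At-++⁻ paper (h A) at′
  ... | A₁ , at | A₃ , at′
    with At-++⁻ paper (h B) at | At-++⁻ paper (h C) at′
  ... | B₁ , at | C₂ , at′
    with At-++⁻ paper (h C) at | At-++⁻ paper (h B) at′
  ... | C₁ , at | B₂ , _
    with At-++⁻ paper (h A) at
  ... | A₂ , _ =
    paper-avoids (length (h B)) (length (h C)) p q (<-wellFounded _)
      (length-positive (h≢[] A)) (length-positive (h≢[] B)) (length-positive (h≢[] C))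
      (At⇒Agree paper (h A) A₁ A₃) (At⇒Agree paper (h A) A₁ A₂)
      (At⇒Agree paper (h B) B₁ B₂) (At⇒Agree paper (h C) C₁ C₂)

-- Squares eventually disappear

Eventually : (ℕ → Set) → Set
Eventually P = ∃ λ N → ∀ n → N ≤ n → P n

-- The maximum of finitely many thresholds serves for all. The thresholds are not computed, hence
-- the double negations; they do no harm when the goal is a contradiction.
Eventually-∀ : ∀ m {P : Fin m → ℕ → Set} →
               (∀ c → ¬ ¬ Eventually (P c)) → ¬ ¬ Eventually (λ n → ∀ c → P c n)
Eventually-∀ zero    ev refute = refute (0 , λ _ _ ())
Eventually-∀ (suc m) ev refute =
  ev zero λ (M , P₀) → Eventually-∀ m (ev ∘ suc) λ (N , P₊) →
    refute (M ⊔ N , λ where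
      n M⊔N≤n zero    → P₀ n (≤-trans (m≤m⊔n M N) M⊔N≤n)
      n M⊔N≤n (suc c) → P₊ n (≤-trans (m≤n⊔m M N) M⊔N≤n) c)

-- There are finitely many words of length `l`, so if `Q` kept recurring, two distant positions
-- would carry the same word. The induction splits `Q` by the last letter of that word.
pigeonhole : (w : InfWord k) (d l : ℕ) {Q : ℕ → Set} →
             (∀ {m n} → Q m → Q n → m + d ≤ n → ¬ Agree w l m n) → ¬ ¬ Eventually (¬_ ∘ Q)
pigeonhole w d zero far refute =
  -- Any two positions agree on zero letters, so a single `m` with `Q` excludes all positions from
  -- `m + d` on.
  refute (0 , λ m _ Qm → refute (m + d , λ n m+d≤n Qn → far Qm Qn m+d≤n (agreeing λ _ ())))
pigeonhole {k} w d (suc l) {Q} far refute =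
  Eventually-∀ k
    (λ c → pigeonhole w d l {λ n → Q n × w (n + l) ≡ c}
      (λ (Qm , m≡c) (Qn , n≡c) m+d≤n agree →
        far Qm Qn m+d≤n (agreeing λ i i<1+l →
          [ letters agree i , (λ { refl → trans m≡c (sym n≡c) }) ]′ (m<1+n⇒m<n∨m≡n i<1+l))))
    λ (N , none) → refute (N , λ n N≤n Qn → none n N≤n (w (n + l)) (Qn , refl))

spell : Word k → Word k → Word k → Fin 3 → Word k
spell X Y Z zero             = X
spell X Y Z (suc zero)       = Y
spell X Y Z (suc (suc zero)) = Z

Square : InfWord k → ℕ → ℕ → Set
Square w l n = Agree w l n (n + l)

-- With `X` for both `A` and `B`, the fragments become XXZX, XZXX and XXZXX, all found within a
-- single XXZXX. The `suc` in the distance leaves at least one letter for the gap `Z`.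
repeated-square : (w : InfWord k) → ∀ {l m n} → 0 < l → m + suc (l + l) ≤ n →
                  Square w l m → Square w l n → Agree w l m n → Occurrence f17 w
repeated-square {k} w {l} {m} {n} 0<l m+d≤n sqₘ sqₙ agree with m≤n⇒∃[o]m+o≡n m+d≤n
... | e , refl = spell X X Z , nonempty , At⇒IsFactor w AACA ∷ At⇒IsFactor w ACAA ∷ At⇒IsFactor w AACAA ∷ []
  where
  X Z : Word k
  X = window w m l
  Z = window w (m + l + l) (suc e)

  |X| : length X ≡ l
  |X| = length-window w m l

  nonempty : ∀ x → spell X X Z x ≢ []
  nonempty (suc (suc zero)) ()
  nonempty zero             X≡[] = contradiction (trans (sym |X|) (cong length X≡[])) λ { refl → contradiction 0<l λ () }
  nonempty (suc zero)       X≡[] = nonempty zero X≡[]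

  to : ∀ {p q} → Agree w l p q → At w p X → At w q X
  to = Agree⇒At w X ∘ subst (λ i → Agree w i _ _) (sym |X|)

  X₁ : At w m X
  X₁ = At-window w m l
  X₂ : At w (m + l) X
  X₂ = to sqₘ X₁
  X₃ : At w n X
  X₃ = to agree X₁
  X₄ : At w (n + l) X
  X₄ = to sqₙ X₃

  _thenX_ : ∀ {p v} → At w p X → At w (p + l) v → At w p (X ++ v)
  _thenX_ {p} {v} at at′ = At-++⁺ w X at (subst (λ i → At w (p + i) v) (sym |X|) at′)

  _thenZ_ : ∀ {v} → At w (m + l + l) Z → At w n v → At w (m + l + l) (Z ++ v)
  _thenZ_ {v} at at′ = At-++⁺ w Z at (subst (λ i → At w i v)
    (trans (end m l e) (cong (m + l + l +_) (sym (length-window w _ (suc e))))) at′)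
    where
    end : ∀ m l e → m + suc (l + l) + e ≡ m + l + l + suc e
    end = solve-∀

  infixr 5 _thenX_ _thenZ_

  Z₁ : At w (m + l + l) Z
  Z₁ = At-window w _ (suc e)
  AACA  = X₁ thenX X₂ thenX Z₁ thenZ X₃ thenX tt
  ACAA  = X₂ thenX Z₁ thenZ X₃ thenX X₄ thenX tt
  AACAA = X₁ thenX X₂ thenX Z₁ thenZ X₃ thenX X₄ thenX tt

-- A square is determined by its half, so the pigeonhole runs over words of length `l`.
squares-disappear : (w : InfWord k) → ¬ Occurrence f17 w → ∀ l → 0 < l → ¬ ¬ Eventually (¬_ ∘ Square w l)
squares-disappear w avoids l 0<l =
  pigeonhole w (suc (l + l)) l λ sqₘ sqₙ m+d≤n agree → avoids (repeated-square w 0<l m+d≤n sqₘ sqₙ agree)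

-- Exhaustive search

_==_ : Fin k → Fin k → Bool
zero  == zero  = true
suc x == suc y = x == y
_     == _     = false

isPrefix : Word k → Word k → Bool
isPrefix []      _       = true
isPrefix (x ∷ u) []      = false
isPrefix (x ∷ u) (y ∷ v) = x == y ∧ isPrefix u v

isInfix : Word k → Word k → Bool
isInfix u []        = false
isInfix u v@(_ ∷ t) = isPrefix u v ∨ isInfix u t

-- Words under search are stored with the last letter first.

endsInSquare : Word k → ℕ → Bool
endsInSquare u l = isPrefix (take l u) (drop l u) ∧ not (null (take l u))

-- Candidate images are cut from the newest letters: read forward, the word ends in CBA, as both
-- ACBA and ABCBA do.
lastMorphism : Word k → ℕ × ℕ → Fin 3 → Word k
lastMorphism u (b , c) = spell (take 1 u) (take b (drop 1 u)) (take c (drop (1 + b) u))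

-- The fragments can be tested on the reversed word as they stand: reversal exchanges ABCA with ACBA
-- and fixes ABCBA.
hasOccurrence : Word k → (Fin 3 → Word k) → Bool
hasOccurrence u h = all (λ φ → isInfix (apply h φ) u) (fragments f17) ∧ all (λ x → not (null (h x))) (allFin 3)

-- With these half-lengths and the two length pairs (|B|, |C|) in isBad, no
-- ternary word of 50 letters survives; both lists were pruned by trial.
squareLengths : List ℕ
squareLengths = 1 ∷ 2 ∷ 3 ∷ 4 ∷ 6 ∷ 8 ∷ 11 ∷ 13 ∷ 15 ∷ 18 ∷ 22 ∷ []

isBad : Word k → Bool
isBad u = any (endsInSquare u) squareLengths
        ∨ any (hasOccurrence u ∘ lastMorphism u) ((1 , 1) ∷ (2 , 3) ∷ [])

-- Running out of fuel counts as survival, so `true` certifies that every branch ends in a bad word.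
isDoomed : ℕ → Word k → Bool
isDoomed zero    u = false
isDoomed (suc n) u = isBad u ∨ all (λ c → isDoomed n (c ∷ u)) (allFin _)

-- Soundness of the search

==-sound : (x y : Fin k) → T (x == y) → x ≡ y
==-sound zero    zero    _  = refl
==-sound (suc x) (suc y) eq = cong suc (==-sound x y eq)

module _ {k : ℕ} where

  isPrefix-sound : (u v : Word k) → T (isPrefix u v) → ∃ λ t → v ≡ u ++ t
  isPrefix-sound []      v       _  = v , refl
  isPrefix-sound (x ∷ u) (y ∷ v) pr with Equivalence.to T-∧ pr
  ... | x=y , pr′ with ==-sound x y x=y | isPrefix-sound u v pr′
  ... | refl | t , refl = t , refl

  isInfix-sound : (u v : Word k) → T (isInfix u v) → ∃ λ s → ∃ λ t → v ≡ s ++ u ++ t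
  isInfix-sound u v@(y ∷ v′) inf with Equivalence.to (T-∨ {isPrefix u v}) inf
  ... | inj₁ pr = [] , isPrefix-sound u v pr
  ... | inj₂ inf′ with isInfix-sound u v′ inf′
  ... | s , t , refl = y ∷ s , t , refl

  not-null : (u : Word k) → T (not (null u)) → u ≢ []
  not-null (_ ∷ _) _ ()

  reverse-≢[] : {u : Word k} → u ≢ [] → reverse u ≢ []
  reverse-≢[] {u} u≢[] eq = u≢[] (trans (sym (reverse-involutive u)) (cong reverse eq))

  reverse-apply : ∀ {v} (h : Fin v → Word k) φ → reverse (apply h φ) ≡ apply (reverse ∘ h) (reverse φ)
  reverse-apply h []      = refl
  reverse-apply h (x ∷ φ) = begin
    reverse (h x ++ apply h φ)                            ≡⟨ reverse-++ (h x) (apply h φ) ⟩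
    reverse (apply h φ) ++ reverse (h x)                  ≡⟨ cong₂ _++_ (reverse-apply h φ) (sym (++-identityʳ _)) ⟩
    apply (reverse ∘ h) (reverse φ) ++ apply (reverse ∘ h) (x ∷ []) ≡⟨ concatMap-++ (reverse ∘ h) (reverse φ) (x ∷ []) ⟨
    apply (reverse ∘ h) (reverse φ ++ x ∷ [])             ≡⟨ cong (apply (reverse ∘ h)) (unfold-reverse x φ) ⟨
    apply (reverse ∘ h) (reverse (x ∷ φ))                 ∎
    where open ≡-Reasoning

squareLengths≤22 : All (_≤ 22) squareLengths
squareLengths≤22 = toWitness {a? = All.all? (_≤? 22) squareLengths} _

-- The word is read from `N` on, where half-lengths 1 to 22 are excluded; 22 is the largest entry of
-- `squareLengths`.
module Search {k : ℕ} (w : InfWord k) (avoids : ¬ Occurrence f17 w) (N : ℕ)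
              (square-free : ∀ n → N ≤ n → ∀ (i : Fin 22) → ¬ Square w (suc (toℕ i)) n) where

  past : ℕ → Word k
  past zero    = []
  past (suc n) = w (N + n) ∷ past n

  length-past : ∀ n → length (past n) ≡ n
  length-past zero    = refl
  length-past (suc n) = cong suc (length-past n)

  past-drop : ∀ n s {v} → past n ≡ s ++ v → ∃ λ m → past m ≡ v
  past-drop n       []      eq = n , eq
  past-drop (suc n) (x ∷ s) eq = past-drop n s (proj₂ (∷-injective eq))

  -- `t` holds the letters older than `v`, so its length is the offset from `N` at which `v` begins.
  past-At : ∀ n v t → past n ≡ v ++ t → At w (N + length t) (reverse v)
  past-At n       []      t eq = tt
  past-At (suc n) (x ∷ v) t eq with ∷-injective eq
  ... | refl , eq′ = subst (At w (N + length t)) (sym (unfold-reverse x v))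
                       (At-++⁺ w (reverse v) (past-At n v t eq′) (cong w position , tt))
    where
    open ≡-Reasoning
    position : N + n ≡ N + length t + length (reverse v)
    position = begin
      N + n                             ≡⟨ cong (N +_) (length-past n) ⟨
      N + length (past n)               ≡⟨ cong (λ u → N + length u) eq′ ⟩
      N + length (v ++ t)               ≡⟨ cong (N +_) (length-++ v) ⟩
      N + (length v + length t)         ≡⟨ cong (N +_) (+-comm (length v) (length t)) ⟩
      N + (length t + length v)         ≡⟨ +-assoc N (length t) (length v) ⟨
      N + length t + length v           ≡⟨ cong (N + length t +_) (length-reverse v) ⟨
      N + length t + length (reverse v) ∎

  infix-IsFactor : ∀ n v → T (isInfix v (past n)) → IsFactor (reverse v) w
  infix-IsFactor n v inf with isInfix-sound v (past n) inf
  ... | s , t , eq with past-drop n s eq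
  ... | m , eq′ = At⇒IsFactor w (past-At m v t eq′)

  no-short-square : ∀ {l n} → N ≤ n → 0 < l → l ≤ 22 → ¬ Square w l n
  no-short-square {suc l} {n} N≤n _ l<22 sq =
    square-free n N≤n (fromℕ< l<22) (subst (λ i → Square w (suc i) n) (sym (toℕ-fromℕ< l<22)) sq)

  no-final-square : ∀ n l → l ≤ 22 → ¬ T (endsInSquare (past n) l)
  no-final-square n l l≤22 ends with Equivalence.to T-∧ ends
  ... | pr , x≢[]ᵇ with isPrefix-sound (take l (past n)) (drop l (past n)) pr
  ... | t , drop≡ = no-short-square (m≤m+n N (length t)) (length-positive (reverse-≢[] (not-null x x≢[]ᵇ))) |x|≤22
                      (subst (Agree w (length (reverse x)) (N + length t)) position (At⇒Agree w (reverse x) second first))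
    where
    x : Word k
    x = take l (past n)
    -- `take` yields at most `l` letters; a bound suffices because every half-length up to 22 is
    -- excluded.
    |x|≤22 : length (reverse x) ≤ 22
    |x|≤22 = ≤-trans (≤-reflexive (trans (length-reverse x) (length-take l (past n)))) (≤-trans (m⊓n≤m l _) l≤22)
    split : past n ≡ x ++ x ++ t
    split = trans (sym (take++drop≡id l (past n))) (cong (x ++_) drop≡)
    -- The copy that comes first in the reversed list is the later one in `w`.
    first : At w (N + length (x ++ t)) (reverse x)
    first = past-At n x (x ++ t) split
    second : At w (N + length t) (reverse x)
    second with past-drop n x split
    ... | m , eq = past-At m x t eq
    position : N + length (x ++ t) ≡ N + length t + length (reverse x)
    position = trans (cong (N +_) (trans (length-++ x) (+-comm (length x) (length t))))
                 (trans (sym (+-assoc N (length t) (length x))) (cong (N + length t +_) (sym (length-reverse x))))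

  no-occurrence : ∀ n h → ¬ T (hasOccurrence (past n) h)
  no-occurrence n h occ
    with Equivalence.to (T-∧ {all (λ φ → isInfix (apply h φ) (past n)) (fragments f17)}) occ
  ... | inf , h≢[]ᵇ with all⁺ (λ φ → isInfix (apply h φ) (past n)) (fragments f17) inf
  ... | ABCA ∷ ACBA ∷ ABCBA ∷ [] =
    avoids ( reverse ∘ h
           , (λ x → reverse-≢[] (nonempty x))
           , factor (A ∷ C ∷ B ∷ A ∷ []) ACBA
           ∷ factor (A ∷ B ∷ C ∷ A ∷ []) ABCA
           ∷ factor (A ∷ B ∷ C ∷ B ∷ A ∷ []) ABCBA
           ∷ [])
    where
    nonempty : ∀ x → h x ≢ []
    nonempty x = not-null (h x) (All.lookup (all⁺ (λ y → not (null (h y))) (allFin 3) h≢[]ᵇ) (∈-allFin x))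
    factor : ∀ φ → T (isInfix (apply h φ) (past n)) → IsFactor (apply (reverse ∘ h) (reverse φ)) w
    factor φ inf = subst (λ u → IsFactor u w) (reverse-apply h φ) (infix-IsFactor n (apply h φ) inf)

  no-bad : ∀ n → ¬ T (isBad (past n))
  no-bad n bad with Equivalence.to (T-∨ {any (endsInSquare (past n)) squareLengths}) bad
  ... | inj₁ sq with find (any⁻ (endsInSquare (past n)) squareLengths sq)
  ... | l , l∈ , ends = no-final-square n l (All.lookup squareLengths≤22 l∈) ends
  no-bad n bad | inj₂ occ with satisfied (any⁻ (hasOccurrence (past n) ∘ lastMorphism (past n)) ((1 , 1) ∷ (2 , 3) ∷ []) occ)
  ... | bc , occ′ = no-occurrence n (lastMorphism (past n) bc) occ′

  -- The letters of `w` pick one branch of the search tree, and no word along it is bad.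
  no-doomed : ∀ fuel n → ¬ T (isDoomed fuel (past n))
  no-doomed (suc fuel) n doomed with Equivalence.to (T-∨ {isBad (past n)}) doomed
  ... | inj₁ bad  = no-bad n bad
  ... | inj₂ next = no-doomed fuel (suc n) (All.lookup (all⁺ (λ c → isDoomed fuel (c ∷ past n)) (allFin k) next) (∈-allFin (w (N + n))))

-- The lower bound: fewer letters

doomed⇒unavoidable : ∀ {k} fuel → isDoomed {k} fuel [] ≡ true → ¬ AvoidableOver f17 k
doomed⇒unavoidable fuel doomed (w , avoids) =
  Eventually-∀ 22 (λ i → squares-disappear w avoids (suc (toℕ i)) (s≤s z≤n))
    λ (N , square-free) → Search.no-doomed w avoids N square-free fuel 0 (Equivalence.from T-≡ doomed)

-- Each `refl` runs the search from the empty word; fuel 50 tests words of at most 49 letters. With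
-- no letters at all, the conjunction over extensions is empty and hence `true`.
fewer-letters : ∀ k → k < 4 → ¬ AvoidableOver f17 k
fewer-letters 0 _ = doomed⇒unavoidable 50 refl
fewer-letters 1 _ = doomed⇒unavoidable 50 refl
fewer-letters 2 _ = doomed⇒unavoidable 50 refl
fewer-letters 3 _ = doomed⇒unavoidable 50 refl
fewer-letters (suc (suc (suc (suc _)))) (s≤s (s≤s (s≤s (s≤s ()))))

theorem17 : AvoidabilityIndex f17 4
theorem17 = four-letters , fewer-letters
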